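{- For every countable finite-by-abelian group $G$, $g(G)<\omega$; i.e. $G$ is generated by finitely many abelian subgroups.
   Context: A group $G$ is finite-by-abelian if its derived subgroup $G'$ is finite. For a group $G$, $g(G)$ denotes the minimum number of abelian subgroups of $G$ needed to generate $G$. -}

module Defs where

open import Level using (Level; _⊔_; suc)
open import Algebra.Bundles using (Group)
open import Data.Nat using (ℕ)
open import Data.Fin using (Fin)
open import Data.List using (List)
open import Data.List.Relation.Unary.Any using (Any)
open import Data.Product using (Σ; ∃; ∃-syntax; _×_)
open import Relation.Unary using (Pred)

module _ {c ℓ : Level} (G : Group c ℓ) where
  open Group G

  -- G is countable: there is a surjection ℕ → G (surjective up to the
  -- group's setoid equality; groups are nonempty).
  Countable : Set (c ⊔ ℓ)
  Countable = Σ (ℕ → Carrier) λ f → ∀ (x : Carrier) → ∃[ n ] (f n ≈ x)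

  record IsSubgroup (H : Pred Carrier (c ⊔ ℓ)) : Set (c ⊔ ℓ) where
    field
      resp    : ∀ {x y} → x ≈ y → H x → H y
      has-ε   : H ε
      closed∙ : ∀ {x y} → H x → H y → H (x ∙ y)
      closed⁻¹ : ∀ {x} → H x → H (x ⁻¹)

  record IsAbelianSubgroup (H : Pred Carrier (c ⊔ ℓ)) : Set (c ⊔ ℓ) where
    field
      isSubgroup : IsSubgroup H
      comm       : ∀ {x y} → H x → H y → (x ∙ y) ≈ (y ∙ x)

  data Generated (S : Pred Carrier (c ⊔ ℓ)) : Carrier → Set (c ⊔ ℓ) where
    gen  : ∀ {x} → S x → Generated S x
    unit : Generated S ε
    mul  : ∀ {x y} → Generated S x → Generated S y → Generated S (x ∙ y)
    inv  : ∀ {x} → Generated S x → Generated S (x ⁻¹)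
    resp : ∀ {x y} → x ≈ y → Generated S x → Generated S y

  IsCommutator : Pred Carrier (c ⊔ ℓ)
  IsCommutator x = ∃[ a ] ∃[ b ] (x ≈ (((a ⁻¹) ∙ (b ⁻¹)) ∙ (a ∙ b)))

  Derived : Pred Carrier (c ⊔ ℓ)
  Derived = Generated IsCommutator

  FiniteSubset : Pred Carrier (c ⊔ ℓ) → Set (c ⊔ ℓ)
  FiniteSubset H = ∃[ xs ] (∀ {x} → H x → Any (x ≈_) xs)

  FiniteByAbelian : Set (c ⊔ ℓ)
  FiniteByAbelian = FiniteSubset Derived

  FinitelyAbelianGenerated : Set (suc (c ⊔ ℓ))
  FinitelyAbelianGenerated =
    ∃[ n ] Σ (Fin n → Pred Carrier (c ⊔ ℓ)) λ A →
      (∀ i → IsAbelianSubgroup (A i)) ×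
      (∀ (x : Carrier) → Generated (λ y → ∃[ i ] A i y) x)

{-# OPTIONS --safe #-}

-- Equality in G is not decidable, so every choice below is made online along the enumeration of G and depends only on
-- the positions at which commutators occur in the finite list xs that covers the derived subgroup.
--
-- Dividing each term of the enumeration by the first earlier term having the same commutator with a given x moves it
-- into the centraliser of x, at the cost of one commuting sequence per possible commutator. Doing this for all x in xs
-- leaves a sequence h whose commutators are central, so that commutators of words in h are products of powers of the
-- entries of xs whose exponents are integer-valued alternating forms on words. An entry that occurs as a commutator has
-- order dividing k! by the pigeonhole principle, k being the length of xs; hence words on which all forms vanish modulo
-- k! commute.
--
-- Modulo a prime, one form is handled by splitting h into two isotropic sequences: project the next term onto the
-- orthogonal complement of the hyperbolic pairs (e , f) found so far; if the result is orthogonal to the first sequence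
-- it joins it, and otherwise it becomes the f of a new pair whose e joins the first sequence. Repeating this on each
-- part for the prime factors of k! and for all forms gives finitely many commuting sequences.
module Submission where

open import Defs
open import Algebra.Bundles using (Group)
import Algebra.Properties.CommutativeSemigroup as CommutativeSemigroupProperties
import Algebra.Properties.Group as GroupProperties
import Algebra.Properties.Monoid.Mult as Mult
open import Data.Fin as Fin using (Fin; zero; suc; toℕ)
import Data.Fin.Properties as Fin
open import Data.Integer using (ℤ; +_; -[1+_]; 0ℤ; 1ℤ; _⊖_; _+_; _*_; -_; _-_; ∣_∣; NonZero)
open import Data.Integer.Divisibility.Signed using (_∣_; divides; quotient; _∣?_; ∣⇒∣ᵤ; ∣ᵤ⇒∣; ∣m∣n⇒∣m+n; ∣m⇒∣-m; ∣n⇒∣m*n; ∣m⇒∣m*n; *-monoˡ-∣)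
import Data.Integer.Properties as ℤ
open import Data.Integer.Tactic.RingSolver using (solve-∀)
open import Data.List using (List; []; _∷_; _++_; map; lookup; length; tabulate)
open import Data.List.Membership.Propositional using (_∈_; find)
open import Data.List.Membership.Propositional.Properties using (∈-lookup)
open import Data.List.Properties using (map-++)
open import Data.List.Relation.Unary.All as All using (All; []; _∷_)
import Data.List.Relation.Unary.All.Properties as All
open import Data.List.Relation.Unary.Any as Any using (Any; here; there)
import Data.List.Relation.Unary.Any.Properties as Any
open import Data.Nat as ℕ using (ℕ; zero; suc; _!)
open import Data.Nat.Coprimality using (Coprime; coprime-Bézout)
import Data.Nat.Divisibility as ℕ
open import Data.Nat.GCD using (module Bézout)
open import Data.Nat.ListAction using (product)
open import Data.Nat.Primality using (Prime; prime⇒irreducible; prime⇒nonZero)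
open import Data.Nat.Primality.Factorisation using (PrimeFactorisation; factorise)
import Data.Nat.Properties as ℕ
open import Data.Product using (Σ; ∃; ∃-syntax; _×_; _,_; proj₁; proj₂)
open import Data.Sum as Sum using (_⊎_; inj₁; inj₂)
open import Function using (_∘_; id)
open import Level using (Level; _⊔_)
open import Relation.Binary.Definitions using (tri<; tri≈; tri>)
open import Relation.Binary.PropositionalEquality using (_≡_; refl; sym; trans; cong; cong₂; subst; subst₂; module ≡-Reasoning)
import Relation.Binary.Reasoning.Setoid as SetoidReasoning
open import Relation.Nullary using (¬_; yes; no; contradiction)
open import Relation.Unary using (Pred)

-- Inverses modulo a prime.

-- A prime not dividing `a` is coprime to `∣ a ∣`, so Bézout applies. The identity over the naturals
-- has two shapes, since it avoids subtraction; the sign of `a` is restored at the end.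
inverse-mod : ∀ {p a} → Prime p → ¬ (+ p ∣ a) → ∃[ c ] (+ p ∣ c * a - 1ℤ)
inverse-mod {p} {a} p-prime p∤a = signed a (natural (coprime-Bézout coprime))
  where
  coprime : Coprime p ∣ a ∣
  coprime (d∣p , d∣a) with prime⇒irreducible p-prime d∣p
  ... | inj₁ d≡1 = d≡1
  ... | inj₂ refl = contradiction (∣ᵤ⇒∣ d∣a) p∤a

  natural : ∀ {n} → Bézout.Identity 1 p n → ∃[ c ] (+ p ∣ c * + n - 1ℤ)
  natural {n} (Bézout.+- x y eq) = - + y , divides (- + x) (begin
    - + y * + n - 1ℤ          ≡⟨ lemma (+ y) (+ n) ⟩
    - (1ℤ + + y * + n)        ≡⟨ cong (λ z → - (1ℤ + z)) (ℤ.pos-* y n) ⟨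
    - + (1 ℕ.+ y ℕ.* n)       ≡⟨ cong (λ z → - + z) eq ⟩
    - + (x ℕ.* p)             ≡⟨ cong -_ (ℤ.pos-* x p) ⟩
    - (+ x * + p)             ≡⟨ ℤ.neg-distribˡ-* (+ x) (+ p) ⟩
    - + x * + p               ∎)
    where
    open ≡-Reasoning
    lemma : ∀ y n → - y * n - 1ℤ ≡ - (1ℤ + y * n)
    lemma = solve-∀
  natural {n} (Bézout.-+ x y eq) = + y , divides (+ x) (begin
    + y * + n - 1ℤ            ≡⟨ cong (_- 1ℤ) (ℤ.pos-* y n) ⟨
    + (y ℕ.* n) - 1ℤ          ≡⟨ cong (λ z → + z - 1ℤ) eq ⟨
    1ℤ + + (x ℕ.* p) - 1ℤ     ≡⟨ lemma (+ (x ℕ.* p)) ⟩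
    + (x ℕ.* p)               ≡⟨ ℤ.pos-* x p ⟩
    + x * + p                 ∎)
    where
    open ≡-Reasoning
    lemma : ∀ z → 1ℤ + z - 1ℤ ≡ z
    lemma = solve-∀

  signed : ∀ a → ∃[ c ] (+ p ∣ c * + ∣ a ∣ - 1ℤ) → ∃[ c ] (+ p ∣ c * a - 1ℤ)
  signed (+ n) c = c
  signed -[1+ n ] (c , d) = - c , subst (λ z → + p ∣ z - 1ℤ) (lemma c (+ suc n)) d
    where
    lemma : ∀ c n → c * n ≡ - c * - n
    lemma = solve-∀

-- Words and integer-valued alternating forms on them.

infixl 6 _·_

data Word : Set where
  var : ℕ → Word
  unit : Word
  _·_ : Word → Word → Word
  inv : Word → Word

-- Substitution turns a sequence of words into a new alphabet, so that a result about all sequences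
-- can be applied again to each part of a splitting.
bind : (ℕ → Word) → Word → Word
bind s (var i) = s i
bind s unit = unit
bind s (u · v) = bind s u · bind s v
bind s (inv u) = inv (bind s u)

infixl 7 _^ℕ_ _^_

_^ℕ_ : Word → ℕ → Word
u ^ℕ zero = unit
u ^ℕ suc n = u · u ^ℕ n

_^_ : Word → ℤ → Word
u ^ + n = u ^ℕ n
u ^ -[1+ n ] = inv (u ^ℕ suc n)

-- Forms need not respect equality in the group, so words with the same value can have different pairings.
record Form : Set where
  field
    ω : Word → Word → ℤ
    ω-·ˡ : ∀ u v w → ω (u · v) w ≡ ω u w + ω v w
    ω-unitˡ : ∀ w → ω unit w ≡ 0ℤ
    ω-invˡ : ∀ u w → ω (inv u) w ≡ - ω u w
    ω-anti : ∀ u v → ω u v ≡ - ω v u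

  ω-^ℕˡ : ∀ u n w → ω (u ^ℕ n) w ≡ + n * ω u w
  ω-^ℕˡ u zero w = ω-unitˡ w
  ω-^ℕˡ u (suc n) w = begin
    ω (u · u ^ℕ n) w          ≡⟨ ω-·ˡ u (u ^ℕ n) w ⟩
    ω u w + ω (u ^ℕ n) w      ≡⟨ cong (λ z → ω u w + z) (ω-^ℕˡ u n w) ⟩
    ω u w + + n * ω u w       ≡⟨ ℤ.suc-* (+ n) (ω u w) ⟨
    + suc n * ω u w           ∎
    where open ≡-Reasoning

  ω-^ˡ : ∀ u n w → ω (u ^ n) w ≡ n * ω u w
  ω-^ˡ u (+ n) w = ω-^ℕˡ u n w
  ω-^ˡ u -[1+ n ] w = begin
    ω (inv (u ^ℕ suc n)) w    ≡⟨ ω-invˡ (u ^ℕ suc n) w ⟩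
    - ω (u ^ℕ suc n) w        ≡⟨ cong -_ (ω-^ℕˡ u (suc n) w) ⟩
    - (+ suc n * ω u w)       ≡⟨ ℤ.neg-distribˡ-* (+ suc n) (ω u w) ⟩
    -[1+ n ] * ω u w          ∎
    where open ≡-Reasoning

  -- An integer equal to its own negative is zero, so antisymmetry suffices even for the prime 2.
  ω-alternating : ∀ u → ω u u ≡ 0ℤ
  ω-alternating u = self-negative (ω u u) (ω-anti u u)
    where
    self-negative : ∀ a → a ≡ - a → a ≡ 0ℤ
    self-negative (+ zero) _ = refl

  ∣-anti : ∀ {m} u v → m ∣ ω u v → m ∣ ω v u
  ∣-anti u v d = subst (_ ∣_) (sym (ω-anti v u)) (∣m⇒∣-m d)

  ∣-bindˡ : ∀ {m} s w → (∀ i → m ∣ ω (s i) w) → ∀ u → m ∣ ω (bind s u) w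
  ∣-bindˡ s w d (var i) = d i
  ∣-bindˡ s w d unit = subst (_ ∣_) (sym (ω-unitˡ w)) (divides 0ℤ refl)
  ∣-bindˡ s w d (u · v) = subst (_ ∣_) (sym (ω-·ˡ (bind s u) (bind s v) w)) (∣m∣n⇒∣m+n (∣-bindˡ s w d u) (∣-bindˡ s w d v))
  ∣-bindˡ s w d (inv u) = subst (_ ∣_) (sym (ω-invˡ (bind s u) w)) (∣m⇒∣-m (∣-bindˡ s w d u))

  ∣-bind : ∀ {m} s → (∀ i j → m ∣ ω (s i) (s j)) → ∀ u v → m ∣ ω (bind s u) (bind s v)
  ∣-bind s d u v = ∣-bindˡ s (bind s v) (λ i → ∣-anti (bind s v) (s i) (∣-bindˡ s (s i) (λ j → d j i) v)) u

open Form

pullback : (ℕ → Word) → Form → Form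
pullback s Ω = record
  { ω = λ u v → ω Ω (bind s u) (bind s v)
  ; ω-·ˡ = λ u v w → ω-·ˡ Ω (bind s u) (bind s v) (bind s w)
  ; ω-unitˡ = λ w → ω-unitˡ Ω (bind s w)
  ; ω-invˡ = λ u w → ω-invˡ Ω (bind s u) (bind s w)
  ; ω-anti = λ u v → ω-anti Ω (bind s u) (bind s v)
  }

module _ (m : ℤ) .{{_ : NonZero m}} (Ω : Form) (m∣ : ∀ u v → m ∣ ω Ω u v) where

  -- The laws survive because the nonzero `m` cancels. This is the passage from one prime factor of
  -- a modulus to the next.
  divide : Form
  divide = record
    { ω = λ u v → quotient (m∣ u v)
    ; ω-·ˡ = λ u v w → cancel (begin
        quotient (m∣ (u · v) w) * m                     ≡⟨ eq (u · v) w ⟨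
        ω Ω (u · v) w                                   ≡⟨ ω-·ˡ Ω u v w ⟩
        ω Ω u w + ω Ω v w                               ≡⟨ cong₂ _+_ (eq u w) (eq v w) ⟩
        quotient (m∣ u w) * m + quotient (m∣ v w) * m   ≡⟨ ℤ.*-distribʳ-+ m (quotient (m∣ u w)) (quotient (m∣ v w)) ⟨
        (quotient (m∣ u w) + quotient (m∣ v w)) * m     ∎)
    ; ω-unitˡ = λ w → cancel (trans (sym (eq unit w)) (ω-unitˡ Ω w))
    ; ω-invˡ = λ u w → cancel (begin
        quotient (m∣ (inv u) w) * m   ≡⟨ eq (inv u) w ⟨
        ω Ω (inv u) w                 ≡⟨ ω-invˡ Ω u w ⟩
        - ω Ω u w                     ≡⟨ cong -_ (eq u w) ⟩
        - (quotient (m∣ u w) * m)     ≡⟨ ℤ.neg-distribˡ-* (quotient (m∣ u w)) m ⟩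
        - quotient (m∣ u w) * m       ∎)
    ; ω-anti = λ u v → cancel (begin
        quotient (m∣ u v) * m         ≡⟨ eq u v ⟨
        ω Ω u v                       ≡⟨ ω-anti Ω u v ⟩
        - ω Ω v u                     ≡⟨ cong -_ (eq v u) ⟩
        - (quotient (m∣ v u) * m)     ≡⟨ ℤ.neg-distribˡ-* (quotient (m∣ v u)) m ⟩
        - quotient (m∣ v u) * m       ∎)
    }
    where
    open ≡-Reasoning
    eq : ∀ u v → ω Ω u v ≡ quotient (m∣ u v) * m
    eq u v = _∣_.equality (m∣ u v)
    cancel : ∀ {i j} → i * m ≡ j * m → i ≡ j
    cancel {i} {j} = ℤ.*-cancelʳ-≡ i j m

-- Splitting a sequence into two isotropic ones modulo a prime.

module Isotropic {c ℓ : Level} (G : Group c ℓ) where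
  open Group G using (Carrier; _∙_; _⁻¹; ε)
  module G = Group G
  module GP = GroupProperties G

  eval : (ℕ → Carrier) → Word → Carrier
  eval h (var i) = h i
  eval h unit = ε
  eval h (u · v) = eval h u ∙ eval h v
  eval h (inv u) = eval h u ⁻¹

  module _ {S : Pred Carrier (c ⊔ ℓ)} where
    generated-cancelʳ : ∀ {x y} → Generated G S (x ∙ y) → Generated G S y → Generated G S x
    generated-cancelʳ {x} {y} xy y′ = resp (GP.//-rightDividesʳ y x) (mul xy (inv y′))

    generated-^ℕ : ∀ h u n → Generated G S (eval h u) → Generated G S (eval h (u ^ℕ n))
    generated-^ℕ h u zero g = unit
    generated-^ℕ h u (suc n) g = mul g (generated-^ℕ h u n g)

    generated-^ : ∀ h u n → Generated G S (eval h u) → Generated G S (eval h (u ^ n))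
    generated-^ h u (+ n) g = generated-^ℕ h u n g
    generated-^ h u -[1+ n ] g = inv (generated-^ℕ h u (suc n) g)

  module Hyperbolic (h : ℕ → Carrier) (Ω : Form) {p : ℕ} (p-prime : Prime p) where
    ⟪_,_⟫ = ω Ω
    P = + p

    _⊥_ : Word → Word → Set
    u ⊥ v = P ∣ ⟪ u , v ⟫

    0∣ : P ∣ 0ℤ
    0∣ = divides 0ℤ refl

    ⊥-sym : ∀ {u v} → u ⊥ v → v ⊥ u
    ⊥-sym {u} {v} = ∣-anti Ω u v

    ⊥-refl : ∀ {u} → u ⊥ u
    ⊥-refl {u} = subst (P ∣_) (sym (ω-alternating Ω u)) 0∣

    ⊥-unitˡ : ∀ {u} → unit ⊥ u
    ⊥-unitˡ {u} = subst (P ∣_) (sym (ω-unitˡ Ω u)) 0∣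

    ⊥-·ˡ : ∀ {u v w} → u ⊥ w → v ⊥ w → (u · v) ⊥ w
    ⊥-·ˡ {u} {v} {w} a b = subst (P ∣_) (sym (ω-·ˡ Ω u v w)) (∣m∣n⇒∣m+n a b)

    ⊥-^ˡ : ∀ {u w} n → u ⊥ w → (u ^ n) ⊥ w
    ⊥-^ˡ {u} {w} n a = subst (P ∣_) (sym (ω-^ˡ Ω u n w)) (∣n⇒∣m*n n a)

    infix 4 _≋_
    _≋_ : ℤ → ℤ → Set
    a ≋ b = P ∣ a - b

    ≋-∣ : ∀ {a b} → a ≋ b → P ∣ b → P ∣ a
    ≋-∣ {a} {b} d e = subst (P ∣_) (lemma a b) (∣m∣n⇒∣m+n d e)
      where
      lemma : ∀ a b → a - b + b ≡ a
      lemma = solve-∀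

    ≋-sym : ∀ {a b} → a ≋ b → b ≋ a
    ≋-sym {a} {b} d = subst (P ∣_) (lemma a b) (∣m⇒∣-m d)
      where
      lemma : ∀ a b → - (a - b) ≡ b - a
      lemma = solve-∀

    Perp : List (Word × Word) → Word → Set
    Perp ps y = All (λ (e , f) → e ⊥ y × f ⊥ y) ps

    data IsHyperbolic : List (Word × Word) → Set where
      [] : IsHyperbolic []
      cons : ∀ {e f ps} → ⟪ e , f ⟫ ≋ 1ℤ → Perp ps e → Perp ps f → IsHyperbolic ps → IsHyperbolic ((e , f) ∷ ps)

    -- Symplectic Gram-Schmidt in multiplicative notation: additively,
    -- `g - ⟪ g , f ⟫ e + ⟪ g , e ⟫ f`, one pair at a time.
    project : List (Word × Word) → Word → Word
    project [] g = g
    project ((e , f) ∷ ps) g = project ps g · e ^ (- ⟪ project ps g , f ⟫) · f ^ ⟪ project ps g , e ⟫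

    expand : ∀ g e f m n y → ⟪ g · e ^ m · f ^ n , y ⟫ ≡ ⟪ g , y ⟫ + m * ⟪ e , y ⟫ + n * ⟪ f , y ⟫
    expand g e f m n y = begin
      ⟪ g · e ^ m · f ^ n , y ⟫                       ≡⟨ ω-·ˡ Ω (g · e ^ m) (f ^ n) y ⟩
      ⟪ g · e ^ m , y ⟫ + ⟪ f ^ n , y ⟫               ≡⟨ cong₂ _+_ (ω-·ˡ Ω g (e ^ m) y) (ω-^ˡ Ω f n y) ⟩
      ⟪ g , y ⟫ + ⟪ e ^ m , y ⟫ + n * ⟪ f , y ⟫       ≡⟨ cong (λ z → ⟪ g , y ⟫ + z + n * ⟪ f , y ⟫) (ω-^ˡ Ω e m y) ⟩
      ⟪ g , y ⟫ + m * ⟪ e , y ⟫ + n * ⟪ f , y ⟫       ∎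
      where open ≡-Reasoning

    expand-≋ : ∀ {g g₀ e f} m n {y} → ⟪ g , y ⟫ ≋ ⟪ g₀ , y ⟫ → P ∣ m * ⟪ e , y ⟫ → P ∣ n * ⟪ f , y ⟫ →
               ⟪ g · e ^ m · f ^ n , y ⟫ ≋ ⟪ g₀ , y ⟫
    expand-≋ {g} {g₀} {e} {f} m n {y} d₁ d₂ d₃ =
      subst (P ∣_)
        (trans (lemma ⟪ g , y ⟫ ⟪ g₀ , y ⟫ (m * ⟪ e , y ⟫) (n * ⟪ f , y ⟫))
          (cong (_- ⟪ g₀ , y ⟫) (sym (expand g e f m n y))))
        (∣m∣n⇒∣m+n (∣m∣n⇒∣m+n d₁ d₂) d₃)
      where
      lemma : ∀ a b c d → a - b + c + d ≡ a + c + d - b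
      lemma = solve-∀

    ≋-refl : ∀ {a} → a ≋ a
    ≋-refl {a} = subst (P ∣_) (sym (ℤ.+-inverseʳ a)) 0∣

    project-≋ : ∀ ps g {y} → Perp ps y → ⟪ project ps g , y ⟫ ≋ ⟪ g , y ⟫
    project-≋ [] g {y} [] = ≋-refl {⟪ g , y ⟫}
    project-≋ ((e , f) ∷ ps) g ((e⊥y , f⊥y) ∷ y-perp) =
      expand-≋ (- ⟪ project ps g , f ⟫) ⟪ project ps g , e ⟫ (project-≋ ps g y-perp)
        (∣n⇒∣m*n (- ⟪ project ps g , f ⟫) e⊥y) (∣n⇒∣m*n ⟪ project ps g , e ⟫ f⊥y)

    -- The signs of the exponents are such that `⟪ e , f ⟫ ≋ 1ℤ` cancels the pairings with the head
    -- pair. Orthogonality to the tail is not disturbed, since `e` and `f` are themselves orthogonal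
    -- to it.
    project-perp : ∀ {ps} → IsHyperbolic ps → ∀ g → Perp ps (project ps g)
    project-perp [] g = []
    project-perp {(e , f) ∷ ps} (cons ef≋1 e-perp f-perp hyp) g =
      (⊥-sym {project ((e , f) ∷ ps) g} ⊥e , ⊥-sym {project ((e , f) ∷ ps) g} ⊥f) ∷
      All.zipWith (λ ((a₁ , a₂) , ((b₁ , b₂) , (c₁ , c₂))) → combine a₁ b₁ c₁ , combine a₂ b₂ c₂)
        (project-perp hyp g , All.zipWith id (e-perp , f-perp))
      where
      g₁ = project ps g
      m = - ⟪ g₁ , f ⟫
      n = ⟪ g₁ , e ⟫

      combine : ∀ {y} → y ⊥ g₁ → y ⊥ e → y ⊥ f → y ⊥ (g₁ · e ^ m · f ^ n)
      combine {y} a b c = ⊥-sym {g₁ · e ^ m · f ^ n}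
        (⊥-·ˡ {g₁ · e ^ m} {f ^ n} (⊥-·ˡ {g₁} {e ^ m} (⊥-sym {y} a) (⊥-^ˡ {e} m (⊥-sym {y} b))) (⊥-^ˡ {f} n (⊥-sym {y} c)))

      ⊥e : (g₁ · e ^ m · f ^ n) ⊥ e
      ⊥e = subst (P ∣_) (begin
        - (n * (⟪ e , f ⟫ - 1ℤ))                         ≡⟨ lemma n m ⟪ e , f ⟫ ⟩
        n + m * 0ℤ + n * - ⟪ e , f ⟫                     ≡⟨ cong₂ (λ a b → n + m * a + n * b) (ω-alternating Ω e) (ω-anti Ω f e) ⟨
        n + m * ⟪ e , e ⟫ + n * ⟪ f , e ⟫                ≡⟨ expand g₁ e f m n e ⟨
        ⟪ g₁ · e ^ m · f ^ n , e ⟫                       ∎) (∣m⇒∣-m (∣n⇒∣m*n n ef≋1))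
        where
        open ≡-Reasoning
        lemma : ∀ n m a → - (n * (a - 1ℤ)) ≡ n + m * 0ℤ + n * - a
        lemma = solve-∀

      ⊥f : (g₁ · e ^ m · f ^ n) ⊥ f
      ⊥f = subst (P ∣_) (begin
        m * (⟪ e , f ⟫ - 1ℤ)                             ≡⟨ lemma ⟪ g₁ , f ⟫ n ⟪ e , f ⟫ ⟩
        ⟪ g₁ , f ⟫ + m * ⟪ e , f ⟫ + n * 0ℤ              ≡⟨ cong (λ a → ⟪ g₁ , f ⟫ + m * ⟪ e , f ⟫ + n * a) (ω-alternating Ω f) ⟨
        ⟪ g₁ , f ⟫ + m * ⟪ e , f ⟫ + n * ⟪ f , f ⟫       ≡⟨ expand g₁ e f m n f ⟨
        ⟪ g₁ · e ^ m · f ^ n , f ⟫                       ∎) (∣n⇒∣m*n m ef≋1)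
        where
        open ≡-Reasoning
        lemma : ∀ k n a → - k * (a - 1ℤ) ≡ k + - k * a + n * 0ℤ
        lemma = solve-∀

    Perpᵉ : List (Word × Word) → Word → Set
    Perpᵉ ps y = All (λ (e , _) → e ⊥ y) ps

    -- Here `f` may pair nontrivially with `y`, but its exponent `⟪ project ps x , e ⟫` is congruent
    -- to `⟪ x , e ⟫` and so vanishes modulo `p`. This keeps the first sequence isotropic when
    -- projected words join it.
    project-≋ᵉ : ∀ {ps} → IsHyperbolic ps → ∀ {x y} → Perpᵉ ps x → Perpᵉ ps y → ⟪ project ps x , y ⟫ ≋ ⟪ x , y ⟫
    project-≋ᵉ [] {x} {y} [] [] = ≋-refl {⟪ x , y ⟫}
    project-≋ᵉ {(e , f) ∷ ps} (cons _ e-perp _ hyp) {x} {y} (e⊥x ∷ x-perp) (e⊥y ∷ y-perp) =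
      expand-≋ {g₀ = x} {f = f} (- ⟪ project ps x , f ⟫) ⟪ project ps x , e ⟫ (project-≋ᵉ hyp x-perp y-perp)
        (∣n⇒∣m*n (- ⟪ project ps x , f ⟫) e⊥y)
        (∣m⇒∣m*n {m = ⟪ project ps x , e ⟫} ⟪ f , y ⟫ (≋-∣ {b = ⟪ x , e ⟫} (project-≋ ps x e-perp) (⊥-sym {e} e⊥x)))

    module _ {S : Pred Carrier (c ⊔ ℓ)} where
      Gen : Word → Set _
      Gen u = Generated G S (eval h u)

      generated-project : ∀ ps g → All (λ (e , f) → Gen e × Gen f) ps → Gen (project ps g) → Gen g
      generated-project [] g [] q = q
      generated-project ((e , f) ∷ ps) g ((eg , fg) ∷ gs) q =
        generated-project ps g gs
          (generated-cancelʳ (generated-cancelʳ q (generated-^ h f ⟪ project ps g , e ⟫ fg))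
            (generated-^ h e (- ⟪ project ps g , f ⟫) eg))

    -- The first components of out are the terms emitted to one isotropic sequence, the second components those emitted to
    -- the other.
    record State (out : List (Word × Word)) : Set where
      field
        pairs : List (Word × Word)
        pairs⊆out : All (_∈ out) pairs
        hyperbolic : IsHyperbolic pairs
        isotropic₁ : ∀ {q r} → q ∈ out → r ∈ out → proj₁ q ⊥ proj₁ r
        isotropic₂ : ∀ {q r} → q ∈ out → r ∈ out → proj₂ q ⊥ proj₂ r
        perp₂ : ∀ {q y} → q ∈ out → Perp pairs y → proj₂ q ⊥ y

    open State

    initial : State []
    initial = record
      { pairs = [] ; pairs⊆out = [] ; hyperbolic = []
      ; isotropic₁ = λ () ; isotropic₂ = λ () ; perp₂ = λ () }

    isotropic-cons : (π : Word × Word → Word) → ∀ {q out} → (∀ {r} → r ∈ out → π q ⊥ π r) →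
      (∀ {r s} → r ∈ out → s ∈ out → π r ⊥ π s) → ∀ {r s} → r ∈ (q ∷ out) → s ∈ (q ∷ out) → π r ⊥ π s
    isotropic-cons π {q} new old (here refl) (here refl) = ⊥-refl {π q}
    isotropic-cons π new old (here refl) (there j) = new j
    isotropic-cons π {q} new old (there i) (here refl) = ⊥-sym {π q} (new i)
    isotropic-cons π new old (there i) (there j) = old i j

    -- Spanning is stated for every `S` so that it can later be used with the set of all emitted
    -- terms, although only those up to this step are consulted.
    record Step (out : List (Word × Word)) (g : Word) : Set (Level.suc (c ⊔ ℓ)) where
      field
        emitted : Word × Word
        next : State (emitted ∷ out)
        generated : ∀ {S : Pred Carrier (c ⊔ ℓ)} →
          (∀ {q} → q ∈ (emitted ∷ out) → Generated G S (eval h (proj₁ q)) × Generated G S (eval h (proj₂ q))) →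
          Generated G S (eval h g)

    step : ∀ {out} → State out → ∀ g → Step out g
    step {out} s g with All.all? (λ q → P ∣? ⟪ proj₁ q , project (pairs s) g ⟫) out
    -- The projected term joins the first sequence; `unit` is a filler that keeps both sequences
    -- indexed alike.
    ... | yes all⊥ = record
      { emitted = g₁ , unit
      ; next = record
        { pairs = pairs s
        ; pairs⊆out = All.map there (pairs⊆out s)
        ; hyperbolic = hyperbolic s
        ; isotropic₁ = isotropic-cons proj₁ (λ {r} i → ⊥-sym {proj₁ r} (All.lookup all⊥ i)) (isotropic₁ s)
        ; isotropic₂ = isotropic-cons proj₂ (λ {r} _ → ⊥-unitˡ {proj₂ r}) (isotropic₂ s)
        ; perp₂ = λ { {y = y} (here refl) _ → ⊥-unitˡ {y} ; (there i) → perp₂ s i }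
        }
      ; generated = λ given →
          generated-project (pairs s) g (All.map (λ i → given (there i)) (pairs⊆out s)) (proj₁ (given (here refl)))
      }
      where g₁ = project (pairs s) g
    -- Some `x` in the first sequence pairs nontrivially with `g₁`. Its projection `x₁` has the same
    -- pairing with `g₁` modulo `p`, and a power of `x₁` becomes the partner of `g₁`.
    ... | no ¬all⊥ with (x , _) , x∈out , x⊥̸g₁ ← find (All.¬All⇒Any¬ (λ q → P ∣? ⟪ proj₁ q , project (pairs s) g ⟫) out ¬all⊥) =
      record
      { emitted = e , g₁
      ; next = record
        { pairs = (e , g₁) ∷ pairs s
        ; pairs⊆out = here refl ∷ All.map there (pairs⊆out s)
        ; hyperbolic = cons (subst (λ z → P ∣ z - 1ℤ) (sym (ω-^ˡ Ω x₁ k g₁)) k-inverse) e-perp g₁-perp (hyperbolic s)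
        ; isotropic₁ = isotropic-cons proj₁
            -- The `e` of each pair belongs to the isotropic first sequence, so both words are
            -- orthogonal to it, and replacing `x` by `x₁` leaves their pairing unchanged modulo
            -- `p`.
            (λ i → ⊥-^ˡ {x₁} k (≋-∣ (project-≋ᵉ (hyperbolic s) (perpᵉ x∈out) (perpᵉ i)) (isotropic₁ s x∈out i)))
            (isotropic₁ s)
        -- Every earlier second component is `unit` or the `f` of some pair, which is what `perp₂`
        -- encodes, and `g₁` is orthogonal to all pairs.
        ; isotropic₂ = isotropic-cons proj₂ (λ {r} i → ⊥-sym {proj₂ r} (perp₂ s i g₁-perp)) (isotropic₂ s)
        ; perp₂ = λ { (here refl) ((_ , g₁⊥y) ∷ _) → g₁⊥y ; (there i) (_ ∷ y-perp) → perp₂ s i y-perp }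
        }
      ; generated = λ given →
          generated-project (pairs s) g (All.map (λ i → given (there i)) (pairs⊆out s)) (proj₂ (given (here refl)))
      }
      where
      g₁ = project (pairs s) g
      x₁ = project (pairs s) x

      g₁-perp : Perp (pairs s) g₁
      g₁-perp = project-perp (hyperbolic s) g

      invertible : ∃[ k ] (k * ⟪ x₁ , g₁ ⟫ ≋ 1ℤ)
      invertible = inverse-mod p-prime λ d →
        x⊥̸g₁ (≋-∣ {b = ⟪ x₁ , g₁ ⟫} (≋-sym {⟪ x₁ , g₁ ⟫} (project-≋ (pairs s) x g₁-perp)) d)

      k = proj₁ invertible
      k-inverse = proj₂ invertible
      e = x₁ ^ k

      e-perp : Perp (pairs s) e
      e-perp = All.map (λ { {a , b} (a⊥ , b⊥) →
          ⊥-sym {e} (⊥-^ˡ {x₁} k (⊥-sym {a} a⊥)) , ⊥-sym {e} (⊥-^ˡ {x₁} k (⊥-sym {b} b⊥)) })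
        (project-perp (hyperbolic s) x)

      perpᵉ : ∀ {q} → q ∈ out → Perpᵉ (pairs s) (proj₁ q)
      perpᵉ j = All.map (λ i → isotropic₁ s i j) (pairs⊆out s)

    run : ℕ → ∃ State
    run zero = [] , initial
    run (suc n) = _ , Step.next (step (proj₂ (run n)) (var n))

    emit : ℕ → Word × Word
    emit n = Step.emitted (step (proj₂ (run n)) (var n))

    emit-∈ : ∀ {i n} → i ℕ.<′ n → emit i ∈ proj₁ (run n)
    emit-∈ ℕ.<′-base = here refl
    emit-∈ (ℕ.≤′-step i<n) = there (emit-∈ i<n)

    ∈-emit : ∀ n {q} → q ∈ proj₁ (run n) → ∃[ i ] (q ≡ emit i)
    ∈-emit (suc n) (here eq) = n , eq
    ∈-emit (suc n) (there i) = ∈-emit n i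

    emit-∈-⊔ : ∀ i j → emit i ∈ proj₁ (run (suc (i ℕ.⊔ j))) × emit j ∈ proj₁ (run (suc (i ℕ.⊔ j)))
    emit-∈-⊔ i j = emit-∈ (ℕ.≤⇒≤′ (ℕ.s≤s (ℕ.m≤m⊔n i j))) , emit-∈ (ℕ.≤⇒≤′ (ℕ.s≤s (ℕ.m≤n⊔m i j)))

    emit-isotropic₁ : ∀ i j → proj₁ (emit i) ⊥ proj₁ (emit j)
    emit-isotropic₁ i j = let a , b = emit-∈-⊔ i j in isotropic₁ (proj₂ (run (suc (i ℕ.⊔ j)))) a b

    emit-isotropic₂ : ∀ i j → proj₂ (emit i) ⊥ proj₂ (emit j)
    emit-isotropic₂ i j = let a , b = emit-∈-⊔ i j in isotropic₂ (proj₂ (run (suc (i ℕ.⊔ j)))) a b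

    emit-generates : ∀ {S : Pred Carrier (c ⊔ ℓ)} →
      (∀ i → Generated G S (eval h (proj₁ (emit i))) × Generated G S (eval h (proj₂ (emit i)))) → ∀ n → Generated G S (h n)
    emit-generates given n = Step.generated (step (proj₂ (run n)) (var n)) λ q∈ → let i , eq = ∈-emit (suc n) q∈ in
      subst (λ q → Generated G _ (eval h (proj₁ q)) × Generated G _ (eval h (proj₂ q))) (sym eq) (given i)

-- Refining colourings through prime factors and several forms.

module Colourings {c ℓ : Level} (G : Group c ℓ) where
  open Group G using (Carrier; _≈_; _∙_; _⁻¹)
  open Isotropic G public

  generated-bind : ∀ {S T : Pred Carrier (c ⊔ ℓ)} →
    (∀ {y} → S y → Generated G T y) → ∀ {x} → Generated G S x → Generated G T x
  generated-bind f (gen s) = f s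
  generated-bind f unit = unit
  generated-bind f (mul x y) = mul (generated-bind f x) (generated-bind f y)
  generated-bind f (inv x) = inv (generated-bind f x)
  generated-bind f (resp eq x) = resp eq (generated-bind f x)

  Terms : List (ℕ → Carrier) → Pred Carrier (c ⊔ ℓ)
  Terms ss y = Any (λ s → ∃[ i ] (y ≈ s i)) ss

  Spans : List (ℕ → Carrier) → Pred Carrier (c ⊔ ℓ)
  Spans ss = Generated G (Terms ss)

  spans-++ˡ : ∀ {ss tt x} → Spans ss x → Spans (ss ++ tt) x
  spans-++ˡ = generated-bind (λ a → gen (Any.++⁺ˡ a))

  spans-++ʳ : ∀ ss {tt x} → Spans tt x → Spans (ss ++ tt) x
  spans-++ʳ ss = generated-bind (λ a → gen (Any.++⁺ʳ ss a))

  evals : (ℕ → Carrier) → List (ℕ → Word) → List (ℕ → Carrier)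
  evals h = map (eval h ∘_)

  eval-bind : ∀ h s u → eval h (bind s u) ≡ eval (eval h ∘ s) u
  eval-bind h s (var i) = refl
  eval-bind h s unit = refl
  eval-bind h s (u · v) = cong₂ _∙_ (eval-bind h s u) (eval-bind h s v)
  eval-bind h s (inv u) = cong _⁻¹ (eval-bind h s u)

  -- Colours are sequences of words rather than of group elements because forms are evaluated on
  -- words. A term of `h` belongs to no single colour; it only lies in their joint span.
  record Colouring (h : ℕ → Carrier) (Q : Word → Word → Set) : Set (c ⊔ ℓ) where
    field
      colours : List (ℕ → Word)
      related : All (λ s → ∀ i j → Q (s i) (s j)) colours
      spans : ∀ n → Spans (evals h colours) (h n)

  open Colouring

  map-colouring : ∀ {h Q Q′} → (∀ {u v} → Q u v → Q′ u v) → Colouring h Q → Colouring h Q′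
  map-colouring f κ = record
    { colours = colours κ ; related = All.map (λ q i j → f (q i j)) (related κ) ; spans = spans κ }

  module _ {h : ℕ → Carrier} {Q Q′ : Word → Word → Set}
    (split : ∀ s → (∀ i j → Q (s i) (s j)) → Colouring (eval h ∘ s) (λ u v → Q′ (bind s u) (bind s v))) where

    bound : ∀ s → List (ℕ → Word) → List (ℕ → Word)
    bound s = map (bind s ∘_)

    terms-bound : ∀ s tt {y} → Terms (evals (eval h ∘ s) tt) y → Terms (evals h (bound s tt)) y
    terms-bound s (t ∷ tt) (here (i , eq)) = here (i , G.trans eq (G.reflexive (sym (eval-bind h s (t i)))))
    terms-bound s (t ∷ tt) (there a) = there (terms-bound s tt a)

    -- Each colour is a sequence in its own right and is split again; the resulting words are
    -- carried back to words in `h` by `bind`.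
    refine-all : ∀ ss → All (λ s → ∀ i j → Q (s i) (s j)) ss →
      Σ (List (ℕ → Word)) λ rr → All (λ s → ∀ i j → Q′ (s i) (s j)) rr ×
        (∀ {x} → Spans (evals h ss) x → Spans (evals h rr) x)
    refine-all [] [] = [] , [] , id
    refine-all (s ∷ ss) (q ∷ qs) with refine-all ss qs
    ... | rr , related-rr , spans-rr =
      bound s (colours κ) ++ rr , All.++⁺ (All.map⁺ (related κ)) related-rr , generated-bind λ
        { (here (i , eq)) → resp (G.sym eq) (subst (λ zs → Spans zs _) (sym (map-++ _ (bound s (colours κ)) rr))
            (spans-++ˡ (generated-bind (λ a → gen (terms-bound s (colours κ) a)) (spans κ i))))
        ; (there a) → subst (λ zs → Spans zs _) (sym (map-++ _ (bound s (colours κ)) rr))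
            (spans-++ʳ (evals h (bound s (colours κ))) (spans-rr (gen a))) }
      where κ = split s q

    refine : Colouring h Q → Colouring h Q′
    refine κ with refine-all (colours κ) (related κ)
    ... | rr , related-rr , spans-rr = record { colours = rr ; related = related-rr ; spans = λ n → spans-rr (spans κ n) }

  trivial-colouring : ∀ {h Q} → (∀ u v → Q u v) → Colouring h Q
  trivial-colouring q = record
    { colours = var ∷ [] ; related = (λ i j → q (var i) (var j)) ∷ [] ; spans = λ n → gen (here (n , G.refl)) }

  prime-colouring : ∀ {p} → Prime p → ∀ Ω h → Colouring h (λ u v → + p ∣ ω Ω u v)
  prime-colouring p-prime Ω h = record
    { colours = (proj₁ ∘ emit) ∷ (proj₂ ∘ emit) ∷ []
    ; related = emit-isotropic₁ ∷ emit-isotropic₂ ∷ []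
    ; spans = emit-generates (λ i → gen (here (i , G.refl)) , gen (there (here (i , G.refl))))
    }
    where open Hyperbolic h Ω p-prime

  -- After the splitting at `p` the form takes multiples of `p` on words in each colour, so it can
  -- be divided by `p` and the remaining primes, possibly equal to `p`, applied to the quotient.
  product-colouring : ∀ {ps} → All Prime ps → ∀ Ω h → Colouring h (λ u v → + product ps ∣ ω Ω u v)
  product-colouring [] Ω h = trivial-colouring λ u v → divides (ω Ω u v) (sym (ℤ.*-identityʳ (ω Ω u v)))
  product-colouring {p ∷ ps} (p-prime ∷ ps-prime) Ω h = refine (λ s p∣ → map-colouring (λ {u} {v} → scale s p∣ u v)
      (product-colouring ps-prime (quotient-form s p∣) (eval h ∘ s))) (prime-colouring p-prime Ω h)
    where
    instance _ = prime⇒nonZero p-prime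
    quotient-form : ∀ s → (∀ i j → + p ∣ ω Ω (s i) (s j)) → Form
    quotient-form s p∣ = divide (+ p) (pullback s Ω) (∣-bind Ω s p∣)
    scale : ∀ s p∣ u v → + product ps ∣ ω (quotient-form s p∣) u v → + (p ℕ.* product ps) ∣ ω Ω (bind s u) (bind s v)
    scale s p∣ u v d = subst₂ _∣_ (trans (ℤ.*-comm (+ product ps) (+ p)) (sym (ℤ.pos-* p (product ps))))
      (sym (_∣_.equality (∣-bind Ω s p∣ u v))) (*-monoˡ-∣ (+ p) d)

  -- Divisibility on a colour extends to all words in it by `∣-bind`, so splitting further for
  -- `Ω zero` keeps what was achieved for the other forms.
  isotropic-colouring : ∀ m .{{_ : ℕ.NonZero m}} k (Ω : Fin k → Form) h → Colouring h (λ u v → ∀ t → + m ∣ ω (Ω t) u v)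
  isotropic-colouring m zero Ω h = trivial-colouring λ _ _ ()
  isotropic-colouring m (suc k) Ω h = refine (λ s m∣ → map-colouring (λ {u} {v} d → λ
      { zero → subst (λ z → + z ∣ ω (Ω zero) (bind s u) (bind s v)) (sym isFactorisation) d
      ; (suc t) → ∣-bind (Ω (suc t)) s (λ i j → m∣ i j t) u v })
      (product-colouring factorsPrime (pullback s (Ω zero)) (eval h ∘ s))) (isotropic-colouring m k (Ω ∘ suc) h)
    where open PrimeFactorisation (factorise m)

-- Alternating forms given by integer matrices.

linear : (ℕ → ℤ) → Word → ℤ
linear φ (var i) = φ i
linear φ unit = 0ℤ
linear φ (u · v) = linear φ u + linear φ v
linear φ (inv u) = - linear φ u

linear-0 : ∀ u → linear (λ _ → 0ℤ) u ≡ 0ℤ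
linear-0 (var i) = refl
linear-0 unit = refl
linear-0 (u · v) = cong₂ _+_ (linear-0 u) (linear-0 v)
linear-0 (inv u) = cong -_ (linear-0 u)

linear-+ : ∀ φ ψ u → linear (λ i → φ i + ψ i) u ≡ linear φ u + linear ψ u
linear-+ φ ψ (var i) = refl
linear-+ φ ψ unit = refl
linear-+ φ ψ (u · v) = trans (cong₂ _+_ (linear-+ φ ψ u) (linear-+ φ ψ v))
  (interchange (linear φ u) (linear ψ u) (linear φ v) (linear ψ v))
  where open CommutativeSemigroupProperties ℤ.+-commutativeSemigroup using (interchange)
linear-+ φ ψ (inv u) = trans (cong -_ (linear-+ φ ψ u)) (ℤ.neg-distrib-+ (linear φ u) (linear ψ u))

linear-neg : ∀ φ u → linear (λ i → - φ i) u ≡ - linear φ u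
linear-neg φ (var i) = refl
linear-neg φ unit = refl
linear-neg φ (u · v) = trans (cong₂ _+_ (linear-neg φ u) (linear-neg φ v)) (sym (ℤ.neg-distrib-+ (linear φ u) (linear φ v)))
linear-neg φ (inv u) = cong -_ (linear-neg φ u)

linear-cong : ∀ {φ ψ} → (∀ i → φ i ≡ ψ i) → ∀ u → linear φ u ≡ linear ψ u
linear-cong eq (var i) = eq i
linear-cong eq unit = refl
linear-cong eq (u · v) = cong₂ _+_ (linear-cong eq u) (linear-cong eq v)
linear-cong eq (inv u) = cong -_ (linear-cong eq u)

-- A word has finitely many letters: either all their coefficients vanish, or one of them supplies
-- `R`.
linear-0⊎ : ∀ {r} {R : Set r} {φ} → (∀ i → φ i ≡ 0ℤ ⊎ R) → ∀ u → linear φ u ≡ 0ℤ ⊎ R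
linear-0⊎ z (var i) = z i
linear-0⊎ z unit = inj₁ refl
linear-0⊎ z (u · v) with linear-0⊎ z u | linear-0⊎ z v
... | inj₂ r | _ = inj₂ r
... | inj₁ _ | inj₂ r = inj₂ r
... | inj₁ p | inj₁ q = inj₁ (cong₂ _+_ p q)
linear-0⊎ z (inv u) with linear-0⊎ z u
... | inj₂ r = inj₂ r
... | inj₁ p = inj₁ (cong -_ p)

module _ (β : ℕ → ℕ → ℤ) (β-anti : ∀ i j → β i j ≡ - β j i) where

  bilinear : Word → Word → ℤ
  bilinear u v = linear (λ i → linear (β i) v) u

  -- Recursion on `u` is enough: expanding the second argument is additivity of `linear` in its
  -- coefficient function.
  bilinear-anti : ∀ u v → bilinear u v ≡ - bilinear v u
  bilinear-anti (var i) v = trans (linear-cong (β-anti i) v) (linear-neg (λ j → β j i) v)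
  bilinear-anti unit v = sym (cong -_ (linear-0 v))
  bilinear-anti (u · u′) v = begin
    bilinear u v + bilinear u′ v          ≡⟨ cong₂ _+_ (bilinear-anti u v) (bilinear-anti u′ v) ⟩
    - bilinear v u + - bilinear v u′      ≡⟨ ℤ.neg-distrib-+ (bilinear v u) (bilinear v u′) ⟨
    - (bilinear v u + bilinear v u′)      ≡⟨ cong -_ (linear-+ (λ j → linear (β j) u) (λ j → linear (β j) u′) v) ⟨
    - bilinear v (u · u′)                 ∎
    where open ≡-Reasoning
  bilinear-anti (inv u) v = cong -_ (trans (bilinear-anti u v) (sym (linear-neg (λ j → linear (β j) u) v)))

  matrix-form : Form
  matrix-form = record
    { ω = bilinear
    ; ω-·ˡ = λ _ _ _ → refl
    ; ω-unitˡ = λ _ → refl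
    ; ω-invˡ = λ _ _ → refl
    ; ω-anti = bilinear-anti
    }

δ : ∀ {k} → Fin k → Fin k → ℤ
δ zero zero = 1ℤ
δ zero (suc t) = 0ℤ
δ (suc s) zero = 0ℤ
δ (suc s) (suc t) = δ s t

δ-support : ∀ {k} (s t : Fin k) → δ s t ≡ 0ℤ ⊎ s ≡ t
δ-support zero zero = inj₂ refl
δ-support zero (suc t) = inj₁ refl
δ-support (suc s) zero = inj₁ refl
δ-support (suc s) (suc t) with δ-support s t
... | inj₁ p = inj₁ p
... | inj₂ refl = inj₂ refl

-- Factorials, and first occurrences of a colour.

∣! : ∀ {k n} .{{_ : ℕ.NonZero n}} → n ℕ.≤ k → n ℕ.∣ k !
∣! {n = suc n} n≤k = ℕ.∣-trans (ℕ.m∣m*n (n !)) (ℕ.m≤n⇒m!∣n! n≤k)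

-- The first index up to n of colour c, or n itself if there is none.
module _ {k : ℕ} (colour : ℕ → Fin k) where
  first : Fin k → ℕ → ℕ
  first c zero = zero
  first c (suc n) with colour (first c n) Fin.≟ c
  ... | yes _ = first c n
  ... | no _ = suc n

  first-colour : ∀ {c} n → colour n ≡ c → colour (first c n) ≡ c
  first-colour zero eq = eq
  first-colour {c} (suc n) eq with colour (first c n) Fin.≟ c
  ... | yes eq′ = eq′
  ... | no _ = eq

  first-stable : ∀ {c m n} → m ℕ.≤′ n → colour (first c m) ≡ c → first c n ≡ first c m
  first-stable ℕ.≤′-refl eq = refl
  first-stable {c} {m} (ℕ.≤′-step {n} m≤n) eq with colour (first c n) Fin.≟ c
  ... | yes _ = first-stable m≤n eq
  ... | no ne = contradiction (trans (cong colour (first-stable m≤n eq)) eq) ne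

  first-unique : ∀ {c} m n → colour (first c m) ≡ c → colour (first c n) ≡ c → first c m ≡ first c n
  first-unique m n p q with ℕ.≤-total m n
  ... | inj₁ m≤n = sym (first-stable (ℕ.≤⇒≤′ m≤n) p)
  ... | inj₂ n≤m = first-stable (ℕ.≤⇒≤′ n≤m) q

-- Commuting elements, powers and commutator identities.

module Commutators {c ℓ : Level} (G : Group c ℓ) where
  open Group G renaming (refl to ≈-refl; sym to ≈-sym; trans to ≈-trans)
  open Colourings G hiding (module G)
  open GroupProperties G
  open Mult monoid using (×-homo-+; ×-homo-1; ×-congʳ; ×-assocˡ) renaming (_×_ to _×ᴳ_)
  open SetoidReasoning setoid

  Commute : Carrier → Carrier → Set ℓ
  Commute x y = x ∙ y ≈ y ∙ x

  commute-∙ : ∀ {x y z} → Commute x y → Commute x z → Commute x (y ∙ z)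
  commute-∙ {x} {y} {z} xy xz = begin
    x ∙ (y ∙ z)   ≈⟨ assoc x y z ⟨
    (x ∙ y) ∙ z   ≈⟨ ∙-congʳ xy ⟩
    (y ∙ x) ∙ z   ≈⟨ assoc y x z ⟩
    y ∙ (x ∙ z)   ≈⟨ ∙-congˡ xz ⟩
    y ∙ (z ∙ x)   ≈⟨ assoc y z x ⟨
    (y ∙ z) ∙ x   ∎

  commute-ε : ∀ {x} → Commute x ε
  commute-ε {x} = ≈-trans (identityʳ x) (≈-sym (identityˡ x))

  commute-⁻¹ : ∀ {x y} → Commute x y → Commute x (y ⁻¹)
  commute-⁻¹ {x} {y} xy = ∙-cancelˡ y _ _ (begin
    y ∙ (x ∙ y ⁻¹)   ≈⟨ assoc y x (y ⁻¹) ⟨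
    (y ∙ x) ∙ y ⁻¹   ≈⟨ ∙-congʳ xy ⟨
    (x ∙ y) ∙ y ⁻¹   ≈⟨ //-rightDividesʳ y x ⟩
    x                ≈⟨ \\-leftDividesˡ y x ⟨
    y ∙ (y ⁻¹ ∙ x)   ∎)

  commute-resp : ∀ {x y z} → y ≈ z → Commute x y → Commute x z
  commute-resp y≈z xy = ≈-trans (∙-congˡ (≈-sym y≈z)) (≈-trans xy (∙-congʳ y≈z))

  commute-generated : ∀ {S : Pred Carrier (c ⊔ ℓ)} {x} →
    (∀ {y} → S y → Commute x y) → ∀ {y} → Generated G S y → Commute x y
  commute-generated f (gen s) = f s
  commute-generated f unit = commute-ε
  commute-generated f (mul y z) = commute-∙ (commute-generated f y) (commute-generated f z)
  commute-generated f (inv y) = commute-⁻¹ (commute-generated f y)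
  commute-generated f (resp eq y) = commute-resp eq (commute-generated f y)

  commute-eval : ∀ {x h} → (∀ i → Commute x (h i)) → ∀ u → Commute x (eval h u)
  commute-eval f (var i) = f i
  commute-eval f unit = commute-ε
  commute-eval f (u · v) = commute-∙ (commute-eval f u) (commute-eval f v)
  commute-eval f (inv u) = commute-⁻¹ (commute-eval f u)

  commute-× : ∀ {x y} n → Commute x y → Commute x (n ×ᴳ y)
  commute-× zero xy = commute-ε
  commute-× (suc n) xy = commute-∙ xy (commute-× n xy)

  pow : Carrier → ℤ → Carrier
  pow x (+ n) = n ×ᴳ x
  pow x -[1+ n ] = (suc n ×ᴳ x) ⁻¹

  commute-pow : ∀ {x y} n → Commute x y → Commute x (pow y n)
  commute-pow (+ n) xy = commute-× n xy
  commute-pow -[1+ n ] xy = commute-⁻¹ (commute-× (suc n) xy)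

  pow-⊖ : ∀ x m n → pow x (m ⊖ n) ≈ m ×ᴳ x ∙ (n ×ᴳ x) ⁻¹
  pow-⊖ x m zero = ≈-sym (≈-trans (∙-congˡ ε⁻¹≈ε) (identityʳ _))
  pow-⊖ x zero (suc n) = ≈-sym (identityˡ _)
  pow-⊖ x (suc m) (suc n) = begin
    pow x (suc m ⊖ suc n)                       ≡⟨ cong (pow x) (ℤ.[1+m]⊖[1+n]≡m⊖n m n) ⟩
    pow x (m ⊖ n)                               ≈⟨ pow-⊖ x m n ⟩
    m ×ᴳ x ∙ (n ×ᴳ x) ⁻¹                        ≈⟨ ∙-congˡ (\\-leftDividesˡ x _) ⟨
    m ×ᴳ x ∙ (x ∙ (x ⁻¹ ∙ (n ×ᴳ x) ⁻¹))         ≈⟨ assoc _ _ _ ⟨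
    m ×ᴳ x ∙ x ∙ (x ⁻¹ ∙ (n ×ᴳ x) ⁻¹)           ≈⟨ ∙-cong (commute-× m ≈-refl) (⁻¹-anti-homo-∙ (n ×ᴳ x) x) ⟨
    suc m ×ᴳ x ∙ (n ×ᴳ x ∙ x) ⁻¹                ≈⟨ ∙-congˡ (⁻¹-cong (commute-× n ≈-refl)) ⟨
    suc m ×ᴳ x ∙ (suc n ×ᴳ x) ⁻¹                ∎

  pow-+ : ∀ x m n → pow x (m + n) ≈ pow x m ∙ pow x n
  pow-+ x (+ m) (+ n) = ×-homo-+ x m n
  pow-+ x (+ m) -[1+ n ] = pow-⊖ x m (suc n)
  pow-+ x -[1+ m ] (+ n) = ≈-trans (pow-⊖ x n (suc m)) (commute-⁻¹ (commute-× (suc m) (≈-sym (commute-× n ≈-refl))))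
  pow-+ x -[1+ m ] -[1+ n ] = begin
    (suc (suc (m ℕ.+ n)) ×ᴳ x) ⁻¹                ≡⟨ cong (λ k → (suc k ×ᴳ x) ⁻¹) (trans (cong suc (ℕ.+-comm m n)) (sym (ℕ.+-suc n m))) ⟩
    ((suc n ℕ.+ suc m) ×ᴳ x) ⁻¹                  ≈⟨ ⁻¹-cong (×-homo-+ x (suc n) (suc m)) ⟩
    (suc n ×ᴳ x ∙ suc m ×ᴳ x) ⁻¹                 ≈⟨ ⁻¹-anti-homo-∙ _ _ ⟩
    (suc m ×ᴳ x) ⁻¹ ∙ (suc n ×ᴳ x) ⁻¹            ∎

  ×-ε : ∀ n → n ×ᴳ ε ≈ ε
  ×-ε zero = ≈-refl
  ×-ε (suc n) = ≈-trans (identityˡ _) (×-ε n)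

  ×-∣ : ∀ {x m n} → m ×ᴳ x ≈ ε → m ℕ.∣ n → n ×ᴳ x ≈ ε
  ×-∣ {x} {m} e (ℕ.divides q refl) = begin
    (q ℕ.* m) ×ᴳ x   ≈⟨ ×-assocˡ x q m ⟨
    q ×ᴳ (m ×ᴳ x)    ≈⟨ ×-congʳ q e ⟩
    q ×ᴳ ε           ≈⟨ ×-ε q ⟩
    ε                ∎

  pow-∣ : ∀ {x m} n → m ×ᴳ x ≈ ε → + m ∣ n → pow x n ≈ ε
  pow-∣ (+ n) e d = ×-∣ e (∣⇒∣ᵤ d)
  pow-∣ -[1+ n ] e d = ≈-trans (⁻¹-cong (×-∣ e (∣⇒∣ᵤ d))) ε⁻¹≈ε

  -- The factors stand in list order, as the entries need not commute; hence the side conditions in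
  -- the lemmas below.
  powers : (xs : List Carrier) → (Fin (length xs) → ℤ) → Carrier
  powers [] n = ε
  powers (x ∷ xs) n = pow x (n zero) ∙ powers xs (n ∘ suc)

  powers-commute : ∀ {y} xs n → (∀ t → n t ≡ 0ℤ ⊎ Commute y (lookup xs t)) → Commute y (powers xs n)
  powers-commute [] n f = commute-ε
  powers-commute {y} (x ∷ xs) n f = commute-∙ (head (f zero)) (powers-commute xs (n ∘ suc) (f ∘ suc))
    where
    head : n zero ≡ 0ℤ ⊎ Commute y x → Commute y (pow x (n zero))
    head (inj₁ eq) = commute-resp (reflexive (cong (pow x) (sym eq))) commute-ε
    head (inj₂ yx) = commute-pow (n zero) yx

  -- Factors with exponents from `n` are moved past those from `m`. A zero exponent contributes `ε`,
  -- so commutation is asked for only where `n` may be nonzero.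
  powers-+ : ∀ xs n m → (∀ t → n t ≡ 0ℤ ⊎ (∀ s → Commute (lookup xs s) (lookup xs t))) →
    powers xs (λ t → n t + m t) ≈ powers xs n ∙ powers xs m
  powers-+ [] n m f = ≈-sym (identityˡ ε)
  powers-+ (x ∷ xs) n m f = begin
    pow x (n zero + m zero) ∙ powers xs (λ t → n (suc t) + m (suc t))   ≈⟨ ∙-cong (pow-+ x (n zero) (m zero)) (powers-+ xs (n ∘ suc) (m ∘ suc) (Sum.map₂ (_∘ suc) ∘ f ∘ suc)) ⟩
    (a ∙ b) ∙ (p ∙ q)                                                   ≈⟨ assoc a b (p ∙ q) ⟩
    a ∙ (b ∙ (p ∙ q))                                                   ≈⟨ ∙-congˡ (assoc b p q) ⟨
    a ∙ ((b ∙ p) ∙ q)                                                   ≈⟨ ∙-congˡ (∙-congʳ bp) ⟩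
    a ∙ ((p ∙ b) ∙ q)                                                   ≈⟨ ∙-congˡ (assoc p b q) ⟩
    a ∙ (p ∙ (b ∙ q))                                                   ≈⟨ assoc a p (b ∙ q) ⟨
    (a ∙ p) ∙ (b ∙ q)                                                   ∎
    where
    a = pow x (n zero)
    b = pow x (m zero)
    p = powers xs (n ∘ suc)
    q = powers xs (m ∘ suc)
    bp : Commute b p
    bp = ≈-sym (commute-pow (m zero) (≈-sym (powers-commute xs (n ∘ suc) (λ t → Sum.map₂ (λ g → g zero) (f (suc t))))))

  powers-ε : ∀ xs n → (∀ t → pow (lookup xs t) (n t) ≈ ε) → powers xs n ≈ ε
  powers-ε [] n f = ≈-refl
  powers-ε (x ∷ xs) n f = ≈-trans (∙-cong (f zero) (powers-ε xs (n ∘ suc) (f ∘ suc))) (identityˡ ε)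

  powers-cong : ∀ xs {n m} → (∀ t → n t ≡ m t) → powers xs n ≈ powers xs m
  powers-cong [] eq = ≈-refl
  powers-cong (x ∷ xs) eq = ∙-cong (reflexive (cong (pow x) (eq zero))) (powers-cong xs (eq ∘ suc))

  powers-δ : ∀ xs t → powers xs (δ t) ≈ lookup xs t
  powers-δ (x ∷ xs) zero = ≈-trans (∙-cong (×-homo-1 x) (powers-ε xs _ (λ _ → ≈-refl))) (identityʳ x)
  powers-δ (x ∷ xs) (suc t) = ≈-trans (identityˡ _) (powers-δ xs t)

  -- With `p` the commutator of `a` and `y`, this is `[ab,y] = [a,y]^b [b,y]` when conjugation by
  -- `b` fixes `p`.
  commutator-∙ : ∀ {a b y p q} → a ∙ y ≈ (y ∙ a) ∙ p → b ∙ y ≈ (y ∙ b) ∙ q → Commute p b →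
    (a ∙ b) ∙ y ≈ (y ∙ (a ∙ b)) ∙ (p ∙ q)
  commutator-∙ {a} {b} {y} {p} {q} ay by pb = begin
    (a ∙ b) ∙ y                 ≈⟨ assoc a b y ⟩
    a ∙ (b ∙ y)                 ≈⟨ ∙-congˡ by ⟩
    a ∙ ((y ∙ b) ∙ q)           ≈⟨ assoc a _ q ⟨
    (a ∙ (y ∙ b)) ∙ q           ≈⟨ ∙-congʳ (assoc a y b) ⟨
    ((a ∙ y) ∙ b) ∙ q           ≈⟨ ∙-congʳ (∙-congʳ ay) ⟩
    (((y ∙ a) ∙ p) ∙ b) ∙ q     ≈⟨ ∙-congʳ (assoc _ p b) ⟩
    ((y ∙ a) ∙ (p ∙ b)) ∙ q     ≈⟨ ∙-congʳ (∙-congˡ pb) ⟩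
    ((y ∙ a) ∙ (b ∙ p)) ∙ q     ≈⟨ ∙-congʳ (assoc _ b p) ⟨
    (((y ∙ a) ∙ b) ∙ p) ∙ q     ≈⟨ ∙-congʳ (∙-congʳ (assoc y a b)) ⟩
    ((y ∙ (a ∙ b)) ∙ p) ∙ q     ≈⟨ assoc _ p q ⟩
    (y ∙ (a ∙ b)) ∙ (p ∙ q)     ∎

  commutator-swap : ∀ {a y p} → a ∙ y ≈ (y ∙ a) ∙ p → y ∙ a ≈ (a ∙ y) ∙ p ⁻¹
  commutator-swap {a} {y} {p} ay = ≈-sym (≈-trans (∙-congʳ ay) (//-rightDividesʳ p (y ∙ a)))

  commutator-⁻¹ : ∀ {a y p} → a ∙ y ≈ (y ∙ a) ∙ p → Commute p a → a ⁻¹ ∙ y ≈ (y ∙ a ⁻¹) ∙ p ⁻¹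
  commutator-⁻¹ {a} {y} {p} ay pa = ≈-sym (∙-cancelˡ a _ _ (begin
    a ∙ ((y ∙ a ⁻¹) ∙ p ⁻¹)         ≈⟨ ∙-congˡ (assoc y (a ⁻¹) (p ⁻¹)) ⟩
    a ∙ (y ∙ (a ⁻¹ ∙ p ⁻¹))         ≈⟨ assoc a y _ ⟨
    (a ∙ y) ∙ (a ⁻¹ ∙ p ⁻¹)         ≈⟨ ∙-congʳ (≈-trans ay (assoc y a p)) ⟩
    (y ∙ (a ∙ p)) ∙ (a ⁻¹ ∙ p ⁻¹)   ≈⟨ ∙-cong (∙-congˡ (≈-sym pa)) (≈-sym (⁻¹-anti-homo-∙ p a)) ⟩
    (y ∙ (p ∙ a)) ∙ (p ∙ a) ⁻¹      ≈⟨ //-rightDividesʳ (p ∙ a) y ⟩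
    y                               ≈⟨ \\-leftDividesˡ a y ⟨
    a ∙ (a ⁻¹ ∙ y)                  ∎))

  //-cancelʳ : ∀ u v w → (u ∙ w) // (v ∙ w) ≈ u // v
  //-cancelʳ u v w = begin
    (u ∙ w) ∙ (v ∙ w) ⁻¹       ≈⟨ ∙-congˡ (⁻¹-anti-homo-∙ v w) ⟩
    (u ∙ w) ∙ (w ⁻¹ ∙ v ⁻¹)    ≈⟨ assoc u w _ ⟩
    u ∙ (w ∙ (w ⁻¹ ∙ v ⁻¹))    ≈⟨ ∙-congˡ (\\-leftDividesˡ w (v ⁻¹)) ⟩
    u ∙ v ⁻¹                   ∎

  -- The quotient `(a ∙ y) // (b ∙ y)` equals `a // b`; after inserting the hypotheses the common
  -- `p` cancels, leaving the conjugate of `a // b` by `y`.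
  commutator-// : ∀ {a b y p} → a ∙ y ≈ (y ∙ a) ∙ p → b ∙ y ≈ (y ∙ b) ∙ p → Commute y (a // b)
  commutator-// {a} {b} {y} {p} ay by = ≈-sym (begin
    (a // b) ∙ y                              ≈⟨ ∙-congʳ (//-cancelʳ a b y) ⟨
    ((a ∙ y) // (b ∙ y)) ∙ y                  ≈⟨ ∙-congʳ (∙-cong ay (⁻¹-cong by)) ⟩
    (((y ∙ a) ∙ p) // ((y ∙ b) ∙ p)) ∙ y      ≈⟨ ∙-congʳ (//-cancelʳ (y ∙ a) (y ∙ b) p) ⟩
    ((y ∙ a) // (y ∙ b)) ∙ y                  ≈⟨ ∙-congʳ (∙-congˡ (⁻¹-anti-homo-∙ y b)) ⟩
    (y ∙ a) ∙ (b ⁻¹ ∙ y ⁻¹) ∙ y               ≈⟨ ∙-congʳ (assoc (y ∙ a) (b ⁻¹) (y ⁻¹)) ⟨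
    (y ∙ a) ∙ b ⁻¹ ∙ y ⁻¹ ∙ y                 ≈⟨ //-rightDividesˡ y _ ⟩
    (y ∙ a) ∙ b ⁻¹                            ≈⟨ assoc y a (b ⁻¹) ⟩
    y ∙ (a // b)                              ∎)

  -- Commutators located in a list covering the derived subgroup.

  module FiniteDerived (xs : List Carrier) (cover : ∀ {d} → Derived G d → Any (d ≈_) xs) where
    private k = length xs

    class : ∀ {d} → Derived G d → Fin k
    class d′ = Any.index (cover d′)

    class-≈ : ∀ {d} (d′ : Derived G d) → d ≈ lookup xs (class d′)
    class-≈ d′ = Any.lookup-index (cover d′)

    derived-commutator : ∀ a b → Derived G ((a ⁻¹ ∙ b ⁻¹) ∙ (a ∙ b))
    derived-commutator a b = gen (a , b , ≈-refl)

    -- Positions can be compared decidably, unlike elements of `G`. Equal positions give equal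
    -- commutators; the converse may fail, for instance if `xs` has repetitions.
    κ : Carrier → Carrier → Fin k
    κ a b = class (derived-commutator a b)

    κ-commutator : ∀ a b → a ∙ b ≈ (b ∙ a) ∙ lookup xs (κ a b)
    κ-commutator a b = begin
      a ∙ b                                         ≈⟨ \\-leftDividesˡ (b ∙ a) (a ∙ b) ⟨
      (b ∙ a) ∙ ((b ∙ a) ⁻¹ ∙ (a ∙ b))              ≈⟨ ∙-congˡ (∙-congʳ (⁻¹-anti-homo-∙ b a)) ⟩
      (b ∙ a) ∙ ((a ⁻¹ ∙ b ⁻¹) ∙ (a ∙ b))           ≈⟨ ∙-congˡ (class-≈ (derived-commutator a b)) ⟩
      (b ∙ a) ∙ lookup xs (κ a b)                   ∎

    derived-× : ∀ {d} n → Derived G d → Derived G (n ×ᴳ d)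
    derived-× zero d′ = unit
    derived-× (suc n) d′ = mul d′ (derived-× n d′)

    -- The `k + 1` powers of `d` with exponents 0 to `k` occupy `k` positions, so two coincide; the
    -- difference of their exponents is positive and at most `k`, hence divides `k !`.
    derived-torsion : ∀ {d} → Derived G d → (k !) ×ᴳ d ≈ ε
    derived-torsion {d} d′ with Fin.pigeonhole (ℕ.n<1+n k) (λ i → class (derived-× (toℕ i) d′))
    ... | i , j , i<j , eq = ×-∣ m×d≈ε (∣! {k} {m} {{ℕ.>-nonZero (ℕ.m<n⇒0<n∸m i<j)}} (ℕ.≤-trans (ℕ.m∸n≤m (toℕ j) (toℕ i)) (Fin.toℕ≤pred[n] j)))
      where
      m = toℕ j ℕ.∸ toℕ i
      m×d≈ε : m ×ᴳ d ≈ ε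
      m×d≈ε = identityʳ-unique (toℕ i ×ᴳ d) (m ×ᴳ d) (begin
        toℕ i ×ᴳ d ∙ m ×ᴳ d                            ≈⟨ ×-homo-+ d (toℕ i) m ⟨
        (toℕ i ℕ.+ m) ×ᴳ d                             ≡⟨ cong (_×ᴳ d) (ℕ.m+[n∸m]≡n (ℕ.<⇒≤ i<j)) ⟩
        toℕ j ×ᴳ d                                     ≈⟨ class-≈ (derived-× (toℕ j) d′) ⟩
        lookup xs (class (derived-× (toℕ j) d′))       ≡⟨ cong (lookup xs) eq ⟨
        lookup xs (class (derived-× (toℕ i) d′))       ≈⟨ class-≈ (derived-× (toℕ i) d′) ⟨
        toℕ i ×ᴳ d                                     ∎)

    Commuting : (ℕ → Carrier) → Set ℓ
    Commuting s = ∀ i j → Commute (s i) (s j)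

    -- Sequences commuting with every entry of the covering list.

    module Class2 (h : ℕ → Carrier) (h-central : ∀ i t → Commute (h i) (lookup xs t)) where

      Realised : Fin k → Set ℓ
      Realised t = (∀ s → Commute (lookup xs s) (lookup xs t)) × (k !) ×ᴳ lookup xs t ≈ ε

      -- Every entry of `xs` commutes with `h i` and `h j`, hence with their commutator.
      realised : ∀ i j → Realised (κ (h i) (h j))
      realised i j = (λ s → commute-resp d≈ (commute-∙ (commute-∙ (commute-⁻¹ (xh s i)) (commute-⁻¹ (xh s j))) (commute-∙ (xh s i) (xh s j)))) ,
        ≈-trans (×-congʳ (k !) (≈-sym d≈)) (derived-torsion d′)
        where
        d′ = derived-commutator (h i) (h j)
        d≈ = class-≈ d′
        xh : ∀ s i → Commute (lookup xs s) (h i)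
        xh s i = ≈-sym (h-central i s)

      -- For `i < j` and varying `t` this is the unit vector at the position of the commutator. The
      -- other half is filled in by antisymmetry, since the positions `κ` chooses for the two orders
      -- are unrelated.
      η : Fin k → ℕ → ℕ → ℤ
      η t i j with ℕ.<-cmp i j
      ... | tri< _ _ _ = δ (κ (h i) (h j)) t
      ... | tri≈ _ _ _ = 0ℤ
      ... | tri> _ _ _ = - δ (κ (h j) (h i)) t

      η-anti : ∀ t i j → η t i j ≡ - η t j i
      η-anti t i j with ℕ.<-cmp i j | ℕ.<-cmp j i
      ... | tri< _ _ _ | tri> _ _ _ = sym (ℤ.neg-involutive _)
      ... | tri≈ _ _ _ | tri≈ _ _ _ = refl
      ... | tri> _ _ _ | tri< _ _ _ = refl
      ... | tri< _ _ j≮i | tri< j<i _ _ = contradiction j<i j≮i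
      ... | tri< _ i≢j _ | tri≈ _ j≡i _ = contradiction (sym j≡i) i≢j
      ... | tri≈ _ i≡j _ | tri< _ j≢i _ = contradiction (sym i≡j) j≢i
      ... | tri≈ _ i≡j _ | tri> _ j≢i _ = contradiction (sym i≡j) j≢i
      ... | tri> _ i≢j _ | tri≈ _ j≡i _ = contradiction (sym j≡i) i≢j
      ... | tri> i≮j _ _ | tri> _ _ i<j = contradiction i<j i≮j

      η-support : ∀ t i j → η t i j ≡ 0ℤ ⊎ Realised t
      η-support t i j with ℕ.<-cmp i j
      ... | tri≈ _ _ _ = inj₁ refl
      ... | tri< _ _ _ with δ-support (κ (h i) (h j)) t
      ...   | inj₁ eq = inj₁ eq
      ...   | inj₂ refl = inj₂ (realised i j)
      η-support t i j | tri> _ _ _ with δ-support (κ (h j) (h i)) t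
      ...   | inj₁ eq = inj₁ (cong -_ eq)
      ...   | inj₂ refl = inj₂ (realised j i)

      form : Fin k → Form
      form t = matrix-form (η t) (η-anti t)

      coords : Word → Word → Fin k → ℤ
      coords u v t = ω (form t) u v

      -- An entry of xs that is not a commutator of h need be neither torsion nor commuting with the others.
      Supported : (Fin k → ℤ) → Set ℓ
      Supported n = ∀ t → n t ≡ 0ℤ ⊎ Realised t

      supported : ∀ u v → Supported (coords u v)
      supported u v t = linear-0⊎ (λ i → linear-0⊎ (η-support t i) v) u

      product-+ : ∀ {n} m → Supported n → powers xs (λ t → n t + m t) ≈ powers xs n ∙ powers xs m
      product-+ {n} m n-supp = powers-+ xs n m (λ t → Sum.map₂ proj₁ (n-supp t))

      product-neg : ∀ {n} → Supported n → powers xs (λ t → - n t) ≈ powers xs n ⁻¹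
      product-neg {n} n-supp = inverseʳ-unique _ _ (≈-trans (≈-sym (product-+ (λ t → - n t) n-supp))
        (powers-ε xs _ (λ t → reflexive (cong (pow (lookup xs t)) (ℤ.+-inverseʳ (n t))))))

      product-central : ∀ n u → Commute (powers xs n) (eval h u)
      product-central n u = commute-eval (λ i → ≈-sym (powers-commute xs n (λ t → inj₂ (h-central i t)))) u

      HasCommutator : Word → Word → Set ℓ
      HasCommutator u v = eval h u ∙ eval h v ≈ (eval h v ∙ eval h u) ∙ powers xs (coords u v)

      hasCommutator-var : ∀ i j → HasCommutator (var i) (var j)
      hasCommutator-var i j with ℕ.<-cmp i j
      ... | tri< _ _ _ = ≈-trans (κ-commutator (h i) (h j)) (∙-congˡ (≈-sym (powers-δ xs (κ (h i) (h j)))))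
      ... | tri≈ _ refl _ = ≈-sym (≈-trans (∙-congˡ (powers-ε xs _ (λ _ → ≈-refl))) (identityʳ _))
      ... | tri> _ _ _ = ≈-trans (commutator-swap (κ-commutator (h j) (h i)))
        (∙-congˡ (≈-sym (≈-trans (product-neg δ-supported) (⁻¹-cong (powers-δ xs (κ (h j) (h i)))))))
        where
        δ-supported : Supported (δ (κ (h j) (h i)))
        δ-supported t with δ-support (κ (h j) (h i)) t
        ... | inj₁ eq = inj₁ eq
        ... | inj₂ refl = inj₂ (realised j i)

      -- Products of powers of entries commute with every word in `h`, so the commutator identities
      -- turn products of words into sums of exponents.
      hasCommutator-extend : ∀ v → (∀ i → HasCommutator (var i) v) → ∀ u → HasCommutator u v
      hasCommutator-extend v f (var i) = f i
      hasCommutator-extend v f unit = begin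
        ε ∙ eval h v                                ≈⟨ identityˡ _ ⟩
        eval h v                                    ≈⟨ identityʳ _ ⟨
        eval h v ∙ ε                                ≈⟨ identityʳ _ ⟨
        (eval h v ∙ ε) ∙ ε                          ≈⟨ ∙-congˡ (powers-ε xs _ (λ _ → ≈-refl)) ⟨
        (eval h v ∙ ε) ∙ powers xs (coords unit v)  ∎
      hasCommutator-extend v f (u · u′) = ≈-trans
        (commutator-∙ (hasCommutator-extend v f u) (hasCommutator-extend v f u′) (product-central (coords u v) u′))
        (∙-congˡ (≈-sym (product-+ (coords u′ v) (supported u v))))
      hasCommutator-extend v f (inv u) = ≈-trans
        (commutator-⁻¹ (hasCommutator-extend v f u) (product-central (coords u v) u))
        (∙-congˡ (≈-sym (product-neg (supported u v))))

      hasCommutator-swap : ∀ u v → HasCommutator u v → HasCommutator v u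
      hasCommutator-swap u v uv = ≈-trans (commutator-swap uv)
        (∙-congˡ (≈-trans (≈-sym (product-neg (supported u v))) (powers-cong xs (λ t → sym (ω-anti (form t) v u)))))

      -- Extension acts on the first argument only: it is applied to `v` against a single letter,
      -- the result is swapped, and then it is applied to `u`.
      hasCommutator : ∀ u v → HasCommutator u v
      hasCommutator u v = hasCommutator-extend v (λ i → hasCommutator-swap v (var i)
        (hasCommutator-extend (var i) (λ j → hasCommutator-var j i) v)) u

      -- In the commutator each exponent is zero, or is a multiple of `k !` on an entry whose order
      -- divides `k !`.
      isotropic⇒commute : ∀ u v → (∀ t → + (k !) ∣ coords u v t) → Commute (eval h u) (eval h v)
      isotropic⇒commute u v d = ≈-trans (hasCommutator u v)
        (≈-trans (∙-congˡ (powers-ε xs _ (λ t → trivial t (supported u v t)))) (identityʳ _))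
        where
        trivial : ∀ t → coords u v t ≡ 0ℤ ⊎ Realised t → pow (lookup xs t) (coords u v t) ≈ ε
        trivial t (inj₁ eq) = reflexive (cong (pow (lookup xs t)) eq)
        trivial t (inj₂ (_ , torsion)) = pow-∣ (coords u v t) torsion (d t)

      class2-colouring : Σ (List (ℕ → Carrier)) λ ss → All Commuting ss × (∀ n → Spans ss (h n))
      class2-colouring = evals h colours ,
        All.map⁺ (All.map (λ {s} d i j → isotropic⇒commute (s i) (s j) (d i j)) related) , spans
        where
        instance _ = k ℕ.!≢0
        open Colouring (isotropic-colouring (k !) k form h)

    -- Moving a sequence into the centraliser of the covering list.

    -- The field `preserves` allows iteration: entering one more centraliser does not leave those
    -- already reached.
    record Centralised (h : ℕ → Carrier) (ys : List Carrier) : Set (c ⊔ ℓ) where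
      field
        terms : ℕ → Carrier
        extra : List (ℕ → Carrier)
        commuting : All Commuting extra
        central : All (λ y → ∀ n → Commute y (terms n)) ys
        spans : ∀ n → Spans (terms ∷ extra) (h n)
        preserves : ∀ {x} → (∀ n → Commute x (h n)) → ∀ n → Commute x (terms n)

    module _ (h : ℕ → Carrier) (y : Carrier) where
      colour : ℕ → Fin k
      colour n = κ (h n) y

      leader : ℕ → ℕ
      leader n = first colour (colour n) n

      -- The value is `ε` until colour `c` has appeared and the first term of that colour from then
      -- on, which avoids deciding whether the colour ever occurs.
      representatives : Fin k → ℕ → Carrier
      representatives c n with colour (first colour c n) Fin.≟ c
      ... | yes _ = h (first colour c n)
      ... | no _ = ε

      representatives-commuting : ∀ c → Commuting (representatives c)
      representatives-commuting c i j with colour (first colour c i) Fin.≟ c | colour (first colour c j) Fin.≟ c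
      ... | no _ | _ = ≈-sym commute-ε
      ... | yes _ | no _ = commute-ε
      ... | yes p | yes q rewrite first-unique colour i j p q = ≈-refl

      representatives-leader : ∀ n → representatives (colour n) n ≡ h (leader n)
      representatives-leader n with colour (first colour (colour n) n) Fin.≟ colour n
      ... | yes _ = refl
      ... | no ne = contradiction (first-colour colour n refl) ne

      -- A term and its leader have the same colour, hence the same commutator with `y`, so their
      -- quotient commutes with `y`. The sequences of representatives give the leaders back.
      centralise-one : Centralised h (y ∷ [])
      centralise-one = record
        { terms = λ n → h n // h (leader n)
        ; extra = tabulate representatives
        ; commuting = All.tabulate⁺ representatives-commuting
        ; central = (λ n → commutator-// (κ-commutator (h n) y) (≈-trans (κ-commutator (h (leader n)) y)
            (∙-congˡ (reflexive (cong (lookup xs) (first-colour colour n refl)))))) ∷ []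
        ; spans = λ n → resp (//-rightDividesˡ (h (leader n)) (h n))
            (mul (gen (here (n , ≈-refl))) (gen (there (Any.tabulate⁺ (colour n) (n , reflexive (sym (representatives-leader n)))))))
        ; preserves = λ f n → commute-∙ (f n) (commute-⁻¹ (f (leader n)))
        }

    centralise : ∀ h ys → Centralised h ys
    centralise h [] = record
      { terms = h ; extra = [] ; commuting = [] ; central = []
      ; spans = λ n → gen (here (n , ≈-refl)) ; preserves = λ f → f }
    centralise h (y ∷ ys) = record
      { terms = C.terms
      ; extra = C.extra ++ B.extra
      ; commuting = All.++⁺ C.commuting B.commuting
      ; central = All.head C.central ∷ All.map C.preserves B.central
      ; spans = λ n → generated-bind (λ
          { (here (i , eq)) → resp (≈-sym eq) (spans-++ˡ (C.spans i))
          ; (there a) → spans-++ʳ (C.terms ∷ C.extra) (gen a) }) (B.spans n)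
      ; preserves = λ f → C.preserves (B.preserves f)
      }
      where
      module B = Centralised (centralise h ys)
      module C = Centralised (centralise-one B.terms y)

    -- Centralising all of `xs` meets the hypothesis of `Class2`; the sequences split off on the way
    -- are already commuting.
    commuting-span : ∀ h → Σ (List (ℕ → Carrier)) λ ss → All Commuting ss × (∀ n → Spans ss (h n))
    commuting-span h = proj₁ central-span ++ extra , All.++⁺ (proj₁ (proj₂ central-span)) commuting , λ n →
      generated-bind (λ
        { (here (i , eq)) → resp (≈-sym eq) (spans-++ˡ (proj₂ (proj₂ central-span) i))
        ; (there a) → spans-++ʳ (proj₁ central-span) (gen a) }) (spans n)
      where
      open Centralised (centralise h xs)
      central-span = Class2.class2-colouring terms (λ i t → ≈-sym (All.lookup central (∈-lookup t) i))

    -- From commuting sequences to abelian subgroups.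

    sequence-subgroup : (ℕ → Carrier) → Pred Carrier (c ⊔ ℓ)
    sequence-subgroup s = Spans (s ∷ [])

    sequence-subgroup-abelian : ∀ {s} → Commuting s → IsAbelianSubgroup G (sequence-subgroup s)
    sequence-subgroup-abelian {s} s-commuting = record
      { isSubgroup = record { resp = resp ; has-ε = unit ; closed∙ = mul ; closed⁻¹ = inv }
      ; comm = λ x∈ y∈ → commute-generated (λ b → ≈-sym (commute-generated (λ a → terms-commute b a) x∈)) y∈
      }
      where
      terms-commute : ∀ {x y} → Terms (s ∷ []) x → Terms (s ∷ []) y → Commute x y
      terms-commute (here (i , x≈)) (here (j , y≈)) = ≈-trans (∙-cong x≈ y≈) (≈-trans (s-commuting i j) (≈-sym (∙-cong y≈ x≈)))

theorem2p2 : ∀ {c ℓ : Level} (G : Group c ℓ) →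
    Countable G → FiniteByAbelian G → FinitelyAbelianGenerated G
theorem2p2 G (f , f-surjective) (xs , cover) =
  length ss , (λ i → sequence-subgroup (lookup ss i)) ,
  (λ i → sequence-subgroup-abelian (All.lookup ss-commuting (∈-lookup i))) ,
  λ x → let n , fn≈x = f-surjective x in
    -- A term of a spanning sequence lies in the subgroup with the index of that sequence in `ss`.
    generated-bind (λ a → gen (Any.index a , gen (here (Any.lookup-index a)))) (resp fn≈x (ss-spans n))
  where
  open Colourings G using (generated-bind)
  open Commutators.FiniteDerived G xs cover
  ss = proj₁ (commuting-span f)
  ss-commuting = proj₁ (proj₂ (commuting-span f))
  ss-spans = proj₂ (proj₂ (commuting-span f))
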